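{- Let $n \ge 1$ be an integer. Every configuration of the game of size $n$ has a solution if and only if the number of coverings of the triangular board of size $n$ by $1\times 1$ and $2\times 1$ pieces is odd.
   Context: For an integer $n\ge 1$, the (triangular Lights Out) game of size $n$ is played on a triangular arrangement of $\beta = n(n+1)/2$ circles ("buttons") with side length $n$: row $r$ ($1\le r\le n$, from top to bottom) contains $r$ buttons, and circles touch as in the usual triangular packing. In coordinates, the buttons are the pairs $(r,s)$ with $1\le s\le r\le n$, and the neighbors of $(r,s)$ (the circles tangent to it) are those among $(r,s-1),(r,s+1),(r-1,s-1),(r-1,s),(r+1,s),(r+1,s+1)$ that belong to the arrangement. Each button is either lit or unlit; a configuration is identified with the set $C$ of lit buttons. Pressing a button switches the state of that button and of all of its neighbors. Since the order of presses is irrelevant and pressing a button twice has no effect, a move is described by a set $X$ of buttons, each pressed once; $C \xrightarrow{X} D$ means that pressing the buttons of $X$ starting from configuration $C$ yields configuration $D$. A set of buttons $X$ is a solution for a configuration $C$ if $C \xrightarrow{X} \emptyset$, i.e. pressing the buttons in $X$ starting from $C$ turns all buttons off. A covering of the board by $1\times 1$ and $2\times 1$ pieces is a partition of the set of buttons into subsets having one or two elements, in which every two-element subset consists of two neighboring buttons. -}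

module Defs where

open import Data.Bool using (Bool; true; false; not; if_then_else_)
open import Data.Fin using (Fin; toℕ)
import Data.Fin.Properties as Fin
open import Data.List using (List; []; _∷_; _++_; map; concatMap; filter; filterᵇ; foldr; length; allFin)
open import Data.List.Relation.Unary.All using (All; all?)
import Data.List.Membership.DecPropositional as DecMembership
open import Data.Empty using (⊥)
open import Data.Nat using (ℕ; suc; _+_; _∸_; _%_; _≟_)
open import Data.Product using (Σ-syntax; _×_; _,_)
open import Data.Product.Properties using (≡-dec)
open import Data.Unit using (⊤; tt)
open import Relation.Binary using (DecidableEquality)
open import Relation.Binary.PropositionalEquality using (_≡_)
open import Relation.Nullary using (Dec; yes; no; does)
open import Relation.Nullary.Decidable using (_⊎-dec_)
open import Relation.Unary using (Decidable)

Button : ℕ → Set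
Button n = Σ[ r ∈ Fin n ] Fin (suc (toℕ r))

-- The coordinates (r , s) with 1 ≤ s ≤ r ≤ n; the Fin components are 0-based.
coords : ∀ {n} → Button n → ℕ × ℕ
coords (r , s) = suc (toℕ r) , suc (toℕ s)

_≟ᴮ_ : ∀ {n} → DecidableEquality (Button n)
_≟ᴮ_ = ≡-dec Fin._≟_ Fin._≟_

-- Every button exactly once.
buttons : ∀ n → List (Button n)
buttons n = concatMap (λ r → map (r ,_) (allFin (suc (toℕ r)))) (allFin n)

open DecMembership (≡-dec _≟_ _≟_) using () renaming (_∈_ to _∈ᶜ_; _∈?_ to _∈ᶜ?_)

-- Truncated subtraction is harmless: r , s ≥ 1, and a pair with a zero
-- component is not the coordinate pair of any button.
tangent : ℕ × ℕ → List (ℕ × ℕ)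
tangent (r , s) =
  (r , s ∸ 1) ∷ (r , s + 1) ∷
  (r ∸ 1 , s ∸ 1) ∷ (r ∸ 1 , s) ∷
  (r + 1 , s) ∷ (r + 1 , s + 1) ∷ []

Neighbor : ∀ {n} → Button n → Button n → Set
Neighbor b c = coords c ∈ᶜ tangent (coords b)

neighbor? : ∀ {n} (b c : Button n) → Dec (Neighbor b c)
neighbor? b c = coords c ∈ᶜ? tangent (coords b)

-- Sets of buttons, used both for the lit buttons and for the pressed ones.
ButtonSet : ℕ → Set
ButtonSet n = Button n → Bool

press : ∀ {n} → Button n → ButtonSet n → ButtonSet n
press b C c = if does ((c ≟ᴮ b) ⊎-dec neighbor? b c) then not (C c) else C c

pressAll : ∀ {n} → ButtonSet n → ButtonSet n → ButtonSet n
pressAll {n} X C = foldr press C (filterᵇ X (buttons n))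

infix 4 _─[_]→_

-- Equality of configurations is pointwise.
_─[_]→_ : ∀ {n} → ButtonSet n → ButtonSet n → ButtonSet n → Set
C ─[ X ]→ D = ∀ b → pressAll X C b ≡ D b

∅ : ∀ {n} → ButtonSet n
∅ _ = false

IsSolution : ∀ {n} → ButtonSet n → ButtonSet n → Set
IsSolution X C = C ─[ X ]→ ∅

-- All sublists; for a list without repetitions, each subset of its elements
-- is represented exactly once.
powerset : ∀ {A : Set} → List A → List (List A)
powerset []       = [] ∷ []
powerset (x ∷ xs) = map (x ∷_) (powerset xs) ++ powerset xs

-- Intended for repetition-free lists, as produced by powerset (buttons n).
IsPiece : ∀ {n} → List (Button n) → Set
IsPiece []              = ⊥
IsPiece (_ ∷ [])        = ⊤
IsPiece (b ∷ c ∷ [])    = Neighbor b c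
IsPiece (_ ∷ _ ∷ _ ∷ _) = ⊥

isPiece? : ∀ {n} → Decidable (IsPiece {n})
isPiece? []              = no λ ()
isPiece? (_ ∷ [])        = yes tt
isPiece? (b ∷ c ∷ [])    = neighbor? b c
isPiece? (_ ∷ _ ∷ _ ∷ _) = no λ ()

pieces : ∀ n → List (List (Button n))
pieces n = filter isPiece? (powerset (buttons n))

blocksContaining : ∀ {n} → Button n → List (List (Button n)) → List (List (Button n))
blocksContaining b = filter (b ∈?_)
  where open DecMembership _≟ᴮ_ using (_∈?_)

-- Every button lies in exactly one block; pieces are nonempty by definition.
IsPartition : ∀ {n} → List (List (Button n)) → Set
IsPartition {n} P = All (λ b → length (blocksContaining b P) ≡ 1) (buttons n)

isPartition? : ∀ {n} → Decidable (IsPartition {n})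
isPartition? {n} P = all? (λ b → length (blocksContaining b P) ≟ 1) (buttons n)

coverings : ∀ n → List (List (List (Button n)))
coverings n = filter isPartition? (powerset (pieces n))

numberOfCoverings : ℕ → ℕ
numberOfCoverings n = length (coverings n)

Odd : ℕ → Set
Odd m = m % 2 ≡ 1

{-# OPTIONS --safe #-}

-- Let a be the symmetric matrix over the field of two elements with
-- a u v = 1 when pressing u toggles v, and let E S be the parity of the number of
-- coverings of a set S of buttons.  Expanding along the piece that contains v gives
--   E S = a v v · E (S - v) + Σ_{j ∈ S - v} a v j · E (S - v - j)   (v ∈ S),
-- and, since symmetric double sums collapse to their diagonal modulo 2,
--   [v ∉ S] · E (S + v) = a v v · E S + Σ_{j ∈ S} a v j · E (S - j)   (all v, S).
-- If E is 1 on the whole board, these relations verify an explicit inverse of a.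
-- If a y is the unit vector at w, the combination of the relations with weights y is
--   Σ_{v ∉ S} y v · E (S + v) = y w · E S + [w ∈ S] · E (S - w),
-- so E S is determined by the values of E on larger sets; were E zero on the whole
-- board, it would be zero everywhere, but E ∅ = 1.

module Submission where

open import Data.Bool using (Bool; true; false; not; _∧_; _∨_; _xor_; if_then_else_)
import Data.Bool.Properties as Bool
open import Data.Bool.Properties
  using (∧-comm; ∧-assoc; ∧-zeroʳ; ∧-identityʳ; ∧-idem; ∧-distribˡ-xor; ∨-identityʳ;
         xor-assoc; xor-same; xor-identityʳ)
open import Data.Fin using (Fin; toℕ)
open import Data.List using (List; []; _∷_; _++_; map; filter; filterᵇ; foldr; length; allFin)
open import Data.List.Properties using (length-filter)
open import Data.List.Membership.Propositional using (_∈_)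
open import Data.List.Membership.Propositional.Properties
  using (∈-filter⁺; ∈-filter⁻; ∈-map⁺; ∈-map⁻; ∈-concatMap⁺; ∈-allFin)
import Data.List.Membership.DecPropositional as DecMembership
open import Data.List.Relation.Binary.Disjoint.Propositional using (Disjoint)
open import Data.List.Relation.Unary.All using (All; []; _∷_; all?)
import Data.List.Relation.Unary.All as All
import Data.List.Relation.Unary.All.Properties as All
open import Data.List.Relation.Unary.Any using (here; there)
import Data.List.Relation.Unary.Any as Any
open import Data.List.Relation.Unary.AllPairs using ([]; _∷_)
import Data.List.Relation.Unary.AllPairs as AllPairs
import Data.List.Relation.Unary.AllPairs.Properties as AllPairs
open import Data.List.Relation.Unary.Unique.Propositional using (Unique)
open import Data.List.Relation.Unary.Unique.Propositional.Properties using (concat⁺; map⁺; allFin⁺)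
open import Data.Nat using (ℕ; zero; suc; _≤_; s≤s; _%_)
import Data.Nat as ℕ
open import Data.Nat.DivMod using ([m+n]%n≡m%n)
import Data.Nat.Properties as ℕ
open import Data.Product using (∃-syntax; _×_; _,_; proj₁; proj₂; map₂)
import Data.Sum as Sum
open import Function using (_∘_)
open import Function.Bundles using (_⇔_; mk⇔; Equivalence)
open import Relation.Binary using (DecidableEquality)
open import Relation.Binary.PropositionalEquality
  using (_≡_; _≢_; _≗_; refl; sym; trans; cong; cong₂; module ≡-Reasoning)
open import Relation.Nullary using (¬_; Dec; yes; no; does; contradiction)
open import Relation.Nullary.Decidable using (dec-true; dec-false; does-⇔; ¬?; _×-dec_; _⊎-dec_)
open import Relation.Unary using (Decidable)
open import Defs

open ≡-Reasoning

private variable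
  A B : Set

-- Boolean identities by evaluation, and finite sums over the two-element field

BoolFun : ℕ → Set
BoolFun zero    = Bool
BoolFun (suc n) = Bool → BoolFun n

agree : ∀ n → BoolFun n → BoolFun n → Bool
agree zero    f g = not (f xor g)
agree (suc n) f g = agree n (f true) (g true) ∧ agree n (f false) (g false)

Pointwise : ∀ n → BoolFun n → BoolFun n → Set
Pointwise zero    f g = f ≡ g
Pointwise (suc n) f g = ∀ b → Pointwise n (f b) (g b)

-- Proof by reflection: for closed `f` and `g` the test `agree` computes over all inputs, so an
-- identity in `n` Boolean variables is settled by `refl`.
truth-table : ∀ n (f g : BoolFun n) → agree n f g ≡ true → Pointwise n f g
truth-table zero    true  true  _  = refl
truth-table zero    false false _  = refl
truth-table (suc n) f g eq true
  with true ← agree n (f true) (g true) in eq₁ = truth-table n (f true) (g true) eq₁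
truth-table (suc n) f g eq false
  with true ← agree n (f true) (g true) = truth-table n (f false) (g false) eq

-- Bool is the field with two elements: xor is addition, ∧ multiplication.
⨁ : List A → (A → Bool) → Bool
⨁ []       f = false
⨁ (x ∷ xs) f = f x xor ⨁ xs f

infixr 8 ⨁
syntax ⨁ xs (λ x → e) = ⨁[ x ∈ xs ] e

⨁-cong : (xs : List A) {f g : A → Bool} → f ≗ g → ⨁ xs f ≡ ⨁ xs g
⨁-cong []       f≗g = refl
⨁-cong (x ∷ xs) f≗g = cong₂ _xor_ (f≗g x) (⨁-cong xs f≗g)

⨁-false : (xs : List A) {f : A → Bool} → (∀ x → f x ≡ false) → ⨁ xs f ≡ false
⨁-false []       f≗0 = refl
⨁-false (x ∷ xs) f≗0 = cong₂ _xor_ (f≗0 x) (⨁-false xs f≗0)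

⨁-xor : (xs : List A) (f g : A → Bool) →
        ⨁[ x ∈ xs ] (f x xor g x) ≡ ⨁ xs f xor ⨁ xs g
⨁-xor []       f g = refl
⨁-xor (x ∷ xs) f g = trans (cong ((f x xor g x) xor_) (⨁-xor xs f g))
  (truth-table 4 (λ p q r s → (p xor q) xor (r xor s)) (λ p q r s → (p xor r) xor (q xor s)) refl
    (f x) (g x) (⨁ xs f) (⨁ xs g))

⨁-∧ : (xs : List A) (c : Bool) (f : A → Bool) → ⨁[ x ∈ xs ] (c ∧ f x) ≡ c ∧ ⨁ xs f
⨁-∧ xs true  f = refl
⨁-∧ xs false f = ⨁-false xs λ _ → refl

⨁-swap : (xs : List A) (ys : List B) (f : A → B → Bool) →
         ⨁[ x ∈ xs ] ⨁[ y ∈ ys ] f x y ≡ ⨁[ y ∈ ys ] ⨁[ x ∈ xs ] f x y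
⨁-swap []       ys f = sym (⨁-false ys λ _ → refl)
⨁-swap (x ∷ xs) ys f = trans (cong (⨁ ys (f x) xor_) (⨁-swap xs ys f))
  (sym (⨁-xor ys (f x) λ y → ⨁[ x ∈ xs ] f x y))

-- Off the diagonal the terms of a symmetric double sum cancel in pairs.
⨁-symmetric : (xs : List A) (f : A → A → Bool) → (∀ x y → f x y ≡ f y x) →
              ⨁[ x ∈ xs ] ⨁[ y ∈ xs ] f x y ≡ ⨁[ x ∈ xs ] f x x
⨁-symmetric []       f f-sym = refl
⨁-symmetric (x ∷ xs) f f-sym = begin
  (f x x xor r) xor ⨁[ y ∈ xs ] (f y x xor ⨁ xs (f y))
    ≡⟨ cong ((f x x xor r) xor_) (⨁-xor xs (λ y → f y x) (λ y → ⨁ xs (f y))) ⟩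
  (f x x xor r) xor (⨁[ y ∈ xs ] f y x xor ⨁[ y ∈ xs ] ⨁ xs (f y))
    ≡⟨ cong₂ (λ p q → (f x x xor r) xor (p xor q))
         (⨁-cong xs λ y → f-sym y x) (⨁-symmetric xs f f-sym) ⟩
  (f x x xor r) xor (r xor d)
    ≡⟨ truth-table 3 (λ p q s → (p xor q) xor (q xor s)) (λ p q s → p xor s) refl (f x x) r d ⟩
  f x x xor d ∎
  where
    r = ⨁ xs (f x)
    d = ⨁[ y ∈ xs ] f y y

module _ (_≟_ : DecidableEquality A) where

  ≟-sym : ∀ x y → does (x ≟ y) ≡ does (y ≟ x)
  ≟-sym x y = does-⇔ (mk⇔ sym sym) (x ≟ y) (y ≟ x)

  ⨁-δ-∉ : (xs : List A) {v : A} (f : A → Bool) → All (v ≢_) xs →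
          ⨁[ x ∈ xs ] (does (x ≟ v) ∧ f x) ≡ false
  ⨁-δ-∉ []       f []          = refl
  ⨁-δ-∉ (x ∷ xs) {v} f (v≢x ∷ v∉xs)
    rewrite dec-false (x ≟ v) (v≢x ∘ sym) = ⨁-δ-∉ xs f v∉xs

  ⨁-δ : {xs : List A} {v : A} (f : A → Bool) → Unique xs → v ∈ xs →
        ⨁[ x ∈ xs ] (does (x ≟ v) ∧ f x) ≡ f v
  ⨁-δ {x ∷ xs} f (x∉xs ∷ _) (here refl)
    rewrite dec-true (x ≟ x) refl | ⨁-δ-∉ xs f x∉xs = xor-identityʳ (f x)
  ⨁-δ {x ∷ xs} {v} f (x∉xs ∷ uniq) (there v∈xs)
    rewrite dec-false (x ≟ v) (All.lookup x∉xs v∈xs) = ⨁-δ f uniq v∈xs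

-- Symmetric matrices over the field with two elements

module SymmetricMatrix
  {V : Set} (_≟_ : DecidableEquality V)
  (vs : List V) (vs-unique : Unique vs) (∈vs : ∀ v → v ∈ vs)
  (a : V → V → Bool) (a-sym : ∀ u v → a u v ≡ a v u)
  where

  infixl 8 _-_ _+_

  _-_ _+_ : (V → Bool) → V → V → Bool
  (S - v) j = S j ∧ not (does (j ≟ v))
  (S + v) j = S j ∨ does (j ≟ v)

  full : V → Bool
  full _ = true

  -self : ∀ S v → (S - v) v ≡ false
  -self S v rewrite dec-true (v ≟ v) refl = ∧-zeroʳ (S v)

  -other : ∀ S {v j} → j ≢ v → (S - v) j ≡ S j
  -other S {v} {j} j≢v rewrite dec-false (j ≟ v) j≢v = ∧-identityʳ (S j)

  -cong : ∀ {S T} v → S ≗ T → S - v ≗ T - v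
  -cong v S≗T j = cong (_∧ not (does (j ≟ v))) (S≗T j)

  -comm : ∀ S u v → S - u - v ≗ S - v - u
  -comm S u v j = truth-table 3 (λ p q r → (p ∧ q) ∧ r) (λ p q r → (p ∧ r) ∧ q) refl
    (S j) (not (does (j ≟ u))) (not (does (j ≟ v)))

  add-remove : ∀ {S v} → S v ≡ false → S + v - v ≗ S
  add-remove {S} {v} v∉S j with j ≟ v
  ... | yes refl = trans (∧-zeroʳ _) (sym v∉S)
  ... | no _ with S j
  ...   | true  = refl
  ...   | false = refl

  ⨁-split : ∀ S {v} (f : V → Bool) → S v ≡ true →
            ⨁[ j ∈ vs ] (S j ∧ f j) ≡ f v xor ⨁[ j ∈ vs ] ((S - v) j ∧ f j)
  ⨁-split S {v} f v∈S = begin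
    ⨁[ j ∈ vs ] (S j ∧ f j)
      ≡⟨ ⨁-cong vs pointwise ⟩
    ⨁[ j ∈ vs ] ((does (j ≟ v) ∧ f j) xor ((S - v) j ∧ f j))
      ≡⟨ ⨁-xor vs (λ j → does (j ≟ v) ∧ f j) (λ j → (S - v) j ∧ f j) ⟩
    ⨁[ j ∈ vs ] (does (j ≟ v) ∧ f j) xor ⨁[ j ∈ vs ] ((S - v) j ∧ f j)
      ≡⟨ cong (_xor ⨁[ j ∈ vs ] ((S - v) j ∧ f j)) (⨁-δ _≟_ f vs-unique (∈vs v)) ⟩
    f v xor ⨁[ j ∈ vs ] ((S - v) j ∧ f j) ∎
    where
      pointwise : ∀ j → S j ∧ f j ≡ (does (j ≟ v) ∧ f j) xor ((S - v) j ∧ f j)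
      pointwise j with j ≟ v
      ... | yes refl rewrite v∈S = sym (xor-identityʳ (f j))
      ... | no _     = cong (_∧ f j) (sym (∧-identityʳ (S j)))

  infixr 7 _·_
  _·_ : (V → V → Bool) → (V → Bool) → V → Bool
  (m · x) u = ⨁[ v ∈ vs ] (m u v ∧ x v)

  -- The off-diagonal terms of the quadratic form cancel in pairs by symmetry of `a`, and
  -- idempotence of `x v` makes the remaining diagonal part linear in `x`.
  quadratic : ∀ x → ⨁[ v ∈ vs ] (x v ∧ (a · x) v) ≡ ⨁[ v ∈ vs ] (x v ∧ a v v)
  quadratic x = begin
    ⨁[ v ∈ vs ] (x v ∧ (a · x) v)
      ≡⟨ ⨁-cong vs (λ v → sym (⨁-∧ vs (x v) λ j → a v j ∧ x j)) ⟩
    ⨁[ v ∈ vs ] ⨁[ j ∈ vs ] (x v ∧ a v j ∧ x j)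
      ≡⟨ ⨁-symmetric vs (λ v j → x v ∧ a v j ∧ x j) f-sym ⟩
    ⨁[ v ∈ vs ] (x v ∧ a v v ∧ x v)
      ≡⟨ ⨁-cong vs (λ v → trans (cong (x v ∧_) (∧-comm (a v v) (x v)))
           (trans (sym (∧-assoc (x v) (x v) (a v v))) (cong (_∧ a v v) (∧-idem (x v))))) ⟩
    ⨁[ v ∈ vs ] (x v ∧ a v v) ∎
    where
      f-sym : ∀ v j → x v ∧ a v j ∧ x j ≡ x j ∧ a j v ∧ x v
      f-sym v j rewrite a-sym v j =
        truth-table 3 (λ p q r → p ∧ (q ∧ r)) (λ p q r → r ∧ (q ∧ p)) refl (x v) (a j v) (x j)

  -- Together these properties say that `E S` is the principal minor of `a` on `S` modulo 2: in the
  -- determinant of a symmetric matrix each permutation cancels against its inverse, so only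
  -- involutions remain, and these are the ways to cut `S` into points and pairs.
  module Matchings
    (E : (V → Bool) → Bool)
    (E-cong : ∀ {S T} → S ≗ T → E S ≡ E T)
    (E-∅ : E (λ _ → false) ≡ true)
    (expand : ∀ S v → S v ≡ true → E S ≡
      (a v v ∧ E (S - v)) xor ⨁[ j ∈ vs ] ((S - v) j ∧ a v j ∧ E (S - v - j)))
    where

    -- The term `j = v` is `d ∧ E U`. Expand every other `E (S - j)` along `v`. The terms `g j k`
    -- that remove two further points are symmetric in `j` and `k` and vanish for `j = k`, so they
    -- cancel. The rest is `d` times the expansion of `E S` along `v`, because `d ∧ d` is `d`.
    relation-∈ : ∀ S v → S v ≡ true →
                 ⨁[ j ∈ vs ] (S j ∧ a v j ∧ E (S - j)) ≡ a v v ∧ E S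
    relation-∈ S v v∈S = begin
      ⨁[ j ∈ vs ] (S j ∧ a v j ∧ E (S - j))
        ≡⟨ ⨁-split S (λ j → a v j ∧ E (S - j)) v∈S ⟩
      (d ∧ E U) xor ⨁[ j ∈ vs ] (U j ∧ a v j ∧ E (S - j))
        ≡⟨ cong ((d ∧ E U) xor_) (⨁-cong vs pointwise) ⟩
      (d ∧ E U) xor ⨁[ j ∈ vs ] ((d ∧ h j) xor ⨁[ k ∈ vs ] g j k)
        ≡⟨ cong ((d ∧ E U) xor_) (⨁-xor vs (λ j → d ∧ h j) (λ j → ⨁[ k ∈ vs ] g j k)) ⟩
      (d ∧ E U) xor (⨁[ j ∈ vs ] (d ∧ h j) xor ⨁[ j ∈ vs ] ⨁[ k ∈ vs ] g j k)
        ≡⟨ cong₂ (λ p q → (d ∧ E U) xor (p xor q)) (⨁-∧ vs d h)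
             (trans (⨁-symmetric vs g g-sym) (⨁-false vs g-diag)) ⟩
      (d ∧ E U) xor ((d ∧ ⨁ vs h) xor false)
        ≡⟨ combine d (expand S v v∈S) ⟩
      d ∧ E S ∎
      where
        d = a v v
        U = S - v
        h = λ j → U j ∧ a v j ∧ E (U - j)
        g = λ j k → U j ∧ a v j ∧ (U - j) k ∧ a v k ∧ E (U - j - k)

        pointwise : ∀ j → U j ∧ a v j ∧ E (S - j) ≡ (d ∧ h j) xor ⨁[ k ∈ vs ] g j k
        pointwise j with j ≟ v
        -- Every term here carries the factor `U v`, and `v` is not in `U`.
        ... | yes refl rewrite ∧-zeroʳ (S j) =
          sym (cong₂ _xor_ (∧-zeroʳ d) (⨁-false vs λ _ → refl))
        ... | no j≢v = begin
          u ∧ a v j ∧ E (S - j)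
            ≡⟨ cong (λ e → u ∧ a v j ∧ e) (expand (S - j) v (trans (-other S (j≢v ∘ sym)) v∈S)) ⟩
          u ∧ a v j ∧ ((d ∧ E (S - j - v)) xor
            ⨁[ k ∈ vs ] ((S - j - v) k ∧ a v k ∧ E (S - j - v - k)))
            ≡⟨ cong₂ (λ p q → u ∧ a v j ∧ ((d ∧ p) xor q)) (E-cong (-comm S j v))
                 (⨁-cong vs λ k → cong₂ (λ p q → p ∧ a v k ∧ q) (-comm S j v k)
                   (E-cong (-cong k (-comm S j v)))) ⟩
          u ∧ a v j ∧ ((d ∧ E (U - j)) xor ⨁ vs r)
            ≡⟨ truth-table 5 (λ p q s t w → p ∧ (q ∧ ((s ∧ t) xor w)))
                 (λ p q s t w → (s ∧ (p ∧ (q ∧ t))) xor ((p ∧ q) ∧ w)) refl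
                 u (a v j) d (E (U - j)) (⨁ vs r) ⟩
          (d ∧ u ∧ a v j ∧ E (U - j)) xor ((u ∧ a v j) ∧ ⨁ vs r)
            ≡⟨ cong ((d ∧ u ∧ a v j ∧ E (U - j)) xor_)
                 (trans (sym (⨁-∧ vs (u ∧ a v j) r)) (⨁-cong vs λ k → ∧-assoc u (a v j) (r k))) ⟩
          (d ∧ u ∧ a v j ∧ E (U - j)) xor ⨁[ k ∈ vs ] (u ∧ a v j ∧ r k) ∎
          where
            -- This is `U j` in the form it takes once the case split has reduced `does (j ≟ v)` to
            -- `false`.
            u = S j ∧ true
            r = λ k → (U - j) k ∧ a v k ∧ E (U - j - k)

        g-sym : ∀ j k → g j k ≡ g k j
        g-sym j k rewrite E-cong (-comm U j k) | ≟-sym _≟_ j k =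
          truth-table 6 (λ p q r s t w → p ∧ (q ∧ ((r ∧ s) ∧ (t ∧ w))))
            (λ p q r s t w → r ∧ (t ∧ ((p ∧ s) ∧ (q ∧ w)))) refl
            (U j) (a v j) (U k) (not (does (k ≟ j))) (a v k) (E (U - k - j))

        g-diag : ∀ j → g j j ≡ false
        g-diag j rewrite -self U j = trans (cong (U j ∧_) (∧-zeroʳ (a v j))) (∧-zeroʳ (U j))

        combine : ∀ c {e e′ w} → e ≡ (c ∧ e′) xor w →
                  (c ∧ e′) xor ((c ∧ w) xor false) ≡ c ∧ e
        combine false _ = refl
        combine true {e′ = e′} {w} refl = cong (e′ xor_) (xor-identityʳ w)

    -- For `v` in `S` the left side is zero and the right side cancels by `relation-∈`. For `v`
    -- outside `S` it is the expansion of `E (S + v)` along `v`, whose removal gives back `S`.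
    relation : ∀ S v → not (S v) ∧ E (S + v) ≡
               (a v v ∧ E S) xor ⨁[ j ∈ vs ] (S j ∧ a v j ∧ E (S - j))
    relation S v with S v in eq
    ... | true  = sym (trans (cong ((a v v ∧ E S) xor_) (relation-∈ S v eq))
                             (xor-same (a v v ∧ E S)))
    ... | false = trans (expand (S + v) v v∈)
      (cong₂ _xor_ (cong (a v v ∧_) (E-cong (add-remove {S} eq)))
        (⨁-cong vs λ j → cong₂ (λ p q → p ∧ a v j ∧ q) (add-remove {S} eq j)
          (E-cong (-cong j (add-remove {S} eq)))))
      where
        v∈ : (S + v) v ≡ true
        v∈ rewrite eq = dec-true (v ≟ v) refl

    -- As E is the determinant modulo 2, Jacobi's identity
    -- C v v · C w w - C v w ² = E full · E (full - v - w) expresses the off-diagonal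
    -- cofactors C v w through principal minors when E full is 1.
    inverse : V → V → Bool
    inverse v w = (E (full - w) ∧ E (full - v)) xor ((full - w) v ∧ E (full - w - v))

    -- The first products sum to `e ∧ a u u` by `relation-∈` on the full set. For `u = w` this and
    -- `R` form the expansion of `E full` along `w`. For other `u`, `relation-∈` on `full - w`
    -- evaluates `R` to the same value, and the two cancel.
    inverse-column : E full ≡ true → ∀ u w → (a · λ v → inverse v w) u ≡ does (u ≟ w)
    inverse-column E-full u w = begin
      ⨁[ v ∈ vs ] (a u v ∧ inverse v w)
        ≡⟨ ⨁-cong vs (λ v → truth-table 5 (λ p q r s t → p ∧ ((q ∧ r) xor (s ∧ t)))
             (λ p q r s t → (q ∧ (p ∧ r)) xor (s ∧ (p ∧ t))) refl
             (a u v) e (E (full - v)) ((full - w) v) (E (full - w - v))) ⟩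
      ⨁[ v ∈ vs ] ((e ∧ a u v ∧ E (full - v)) xor ((full - w) v ∧ a u v ∧ E (full - w - v)))
        ≡⟨ ⨁-xor vs (λ v → e ∧ a u v ∧ E (full - v)) _ ⟩
      ⨁[ v ∈ vs ] (e ∧ a u v ∧ E (full - v)) xor R
        ≡⟨ cong (_xor R) (trans (⨁-∧ vs e _) (cong (e ∧_)
             (trans (relation-∈ full u refl) (trans (cong (a u u ∧_) E-full) (∧-identityʳ (a u u)))))) ⟩
      (e ∧ a u u) xor R
        ≡⟨ finish ⟩
      does (u ≟ w) ∎
      where
        e = E (full - w)
        R = ⨁[ v ∈ vs ] ((full - w) v ∧ a u v ∧ E (full - w - v))
        finish : (e ∧ a u u) xor R ≡ does (u ≟ w)
        finish with u ≟ w
        ... | yes refl = trans (cong (_xor R) (∧-comm e (a u u)))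
                               (trans (sym (expand full u refl)) E-full)
        ... | no u≢w = trans (cong ((e ∧ a u u) xor_)
                         (trans (relation-∈ (full - w) u (-other full u≢w)) (∧-comm (a u u) e)))
                         (xor-same (e ∧ a u u))

    odd⇒solvable : E full ≡ true → ∀ c → ∃[ x ] a · x ≗ c
    odd⇒solvable E-full c = inverse · c , λ u → begin
      ⨁[ v ∈ vs ] (a u v ∧ (⨁[ w ∈ vs ] (inverse v w ∧ c w)))
        ≡⟨ ⨁-cong vs (λ v → sym (⨁-∧ vs (a u v) _)) ⟩
      ⨁[ v ∈ vs ] ⨁[ w ∈ vs ] (a u v ∧ inverse v w ∧ c w)
        ≡⟨ ⨁-swap vs vs _ ⟩
      ⨁[ w ∈ vs ] ⨁[ v ∈ vs ] (a u v ∧ inverse v w ∧ c w)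
        ≡⟨ ⨁-cong vs (λ w → ⨁-cong vs λ v →
             truth-table 3 (λ p q r → p ∧ (q ∧ r)) (λ p q r → r ∧ (p ∧ q)) refl (a u v) (inverse v w) (c w)) ⟩
      ⨁[ w ∈ vs ] ⨁[ v ∈ vs ] (c w ∧ a u v ∧ inverse v w)
        ≡⟨ ⨁-cong vs (λ w → ⨁-∧ vs (c w) _) ⟩
      ⨁[ w ∈ vs ] (c w ∧ (a · λ v → inverse v w) u)
        ≡⟨ ⨁-cong vs (λ w → trans
             (cong (c w ∧_) (trans (inverse-column E-full u w) (≟-sym _≟_ u w)))
             (∧-comm (c w) (does (w ≟ u)))) ⟩
      ⨁[ w ∈ vs ] (does (w ≟ u) ∧ c w)
        ≡⟨ ⨁-δ _≟_ c vs-unique (∈vs u) ⟩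
      c u ∎

    -- Add up the instances of `relation` with weights `y v`. In the double sum, symmetry of `a`
    -- turns the sum over `v` into an entry of `a · y`, which selects `j = w`. The diagonal terms
    -- are handled by `quadratic`, which replaces the diagonal of `a` by `a · y` and so leaves
    -- `y w`.
    dual-relation : ∀ {w} y → (a · y ≗ λ u → does (u ≟ w)) → ∀ S →
                    ⨁[ v ∈ vs ] (y v ∧ not (S v) ∧ E (S + v)) ≡
                    (y w ∧ E S) xor (S w ∧ E (S - w))
    dual-relation {w} y ay≗δ S = begin
      ⨁[ v ∈ vs ] (y v ∧ not (S v) ∧ E (S + v))
        ≡⟨ ⨁-cong vs (λ v → cong (y v ∧_) (relation S v)) ⟩
      ⨁[ v ∈ vs ] (y v ∧ ((a v v ∧ E S) xor ⨁[ j ∈ vs ] (S j ∧ a v j ∧ E (S - j))))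
        ≡⟨ ⨁-cong vs (λ v → trans (∧-distribˡ-xor (y v) _ _)
             (cong₂ _xor_
               (truth-table 3 (λ p q r → p ∧ (q ∧ r)) (λ p q r → r ∧ (p ∧ q)) refl
                 (y v) (a v v) (E S))
               (sym (⨁-∧ vs (y v) _)))) ⟩
      ⨁[ v ∈ vs ] ((E S ∧ y v ∧ a v v) xor ⨁[ j ∈ vs ] (y v ∧ S j ∧ a v j ∧ E (S - j)))
        ≡⟨ ⨁-xor vs (λ v → E S ∧ y v ∧ a v v) _ ⟩
      ⨁[ v ∈ vs ] (E S ∧ y v ∧ a v v) xor ⨁[ v ∈ vs ] ⨁[ j ∈ vs ] (y v ∧ S j ∧ a v j ∧ E (S - j))
        ≡⟨ cong₂ _xor_ diagonal columns ⟩
      (y w ∧ E S) xor (S w ∧ E (S - w)) ∎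
      where
        diagonal : ⨁[ v ∈ vs ] (E S ∧ y v ∧ a v v) ≡ y w ∧ E S
        diagonal = begin
          ⨁[ v ∈ vs ] (E S ∧ y v ∧ a v v) ≡⟨ ⨁-∧ vs (E S) _ ⟩
          E S ∧ (⨁[ v ∈ vs ] (y v ∧ a v v)) ≡⟨ cong (E S ∧_) (sym (quadratic y)) ⟩
          E S ∧ (⨁[ v ∈ vs ] (y v ∧ (a · y) v))
            ≡⟨ cong (E S ∧_) (⨁-cong vs λ v →
                 trans (cong (y v ∧_) (ay≗δ v)) (∧-comm (y v) (does (v ≟ w)))) ⟩
          E S ∧ (⨁[ v ∈ vs ] (does (v ≟ w) ∧ y v))
            ≡⟨ cong (E S ∧_) (⨁-δ _≟_ y vs-unique (∈vs w)) ⟩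
          E S ∧ y w ≡⟨ ∧-comm (E S) (y w) ⟩
          y w ∧ E S ∎
        columns : ⨁[ v ∈ vs ] ⨁[ j ∈ vs ] (y v ∧ S j ∧ a v j ∧ E (S - j)) ≡ S w ∧ E (S - w)
        columns = begin
          ⨁[ v ∈ vs ] ⨁[ j ∈ vs ] (y v ∧ S j ∧ a v j ∧ E (S - j))
            ≡⟨ ⨁-swap vs vs _ ⟩
          ⨁[ j ∈ vs ] ⨁[ v ∈ vs ] (y v ∧ S j ∧ a v j ∧ E (S - j))
            ≡⟨ ⨁-cong vs (λ j → ⨁-cong vs λ v → trans
                 (truth-table 4 (λ p q r s → p ∧ (q ∧ (r ∧ s))) (λ p q r s → (q ∧ s) ∧ (r ∧ p)) refl
                   (y v) (S j) (a v j) (E (S - j)))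
                 (cong (λ b → (S j ∧ E (S - j)) ∧ b ∧ y v) (a-sym v j))) ⟩
          ⨁[ j ∈ vs ] ⨁[ v ∈ vs ] ((S j ∧ E (S - j)) ∧ a j v ∧ y v)
            ≡⟨ ⨁-cong vs (λ j → trans (⨁-∧ vs (S j ∧ E (S - j)) _)
                 (trans (cong ((S j ∧ E (S - j)) ∧_) (ay≗δ j))
                        (∧-comm (S j ∧ E (S - j)) (does (j ≟ w))))) ⟩
          ⨁[ j ∈ vs ] (does (j ≟ w) ∧ S j ∧ E (S - j))
            ≡⟨ ⨁-δ _≟_ (λ j → S j ∧ E (S - j)) vs-unique (∈vs w) ⟩
          S w ∧ E (S - w) ∎

    -- Descent from the full set to the empty set

    open DecMembership _≟_ using (_∈?_)

    -- Sets are presented as complements of lists, possibly with repetitions, so that the length of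
    -- the list bounds the distance from the full set and serves as the induction measure.
    ∁ : List V → V → Bool
    ∁ l j = not (does (j ∈? l))

    module _ (solvable : ∀ c → ∃[ x ] a · x ≗ c) (E-full : E full ≡ false) where

      -- Take `y` with `a · y` the unit vector at `w`. In `dual-relation` every term except
      -- `S w ∧ E (S - w)` contains `E S` or the value of `E` on a larger set.
      vanishes-remove : ∀ S w → E S ≡ false → (∀ v → S v ≡ false → E (S + v) ≡ false) →
                        S w ≡ true → E (S - w) ≡ false
      vanishes-remove S w E-S E-S+ w∈S with y , ay≗δ ← solvable (λ u → does (u ≟ w)) = begin
        E (S - w)                                 ≡⟨ cong (_∧ E (S - w)) (sym w∈S) ⟩
        S w ∧ E (S - w)                           ≡⟨ cong (_xor (S w ∧ E (S - w)))
                                                       (sym (trans (cong (y w ∧_) E-S) (∧-zeroʳ (y w)))) ⟩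
        (y w ∧ E S) xor (S w ∧ E (S - w))         ≡⟨ sym (dual-relation y ay≗δ S) ⟩
        ⨁[ v ∈ vs ] (y v ∧ not (S v) ∧ E (S + v)) ≡⟨ ⨁-false vs zero-term ⟩
        false                                     ∎
        where
          zero-term : ∀ v → y v ∧ not (S v) ∧ E (S + v) ≡ false
          zero-term v with S v in eq
          ... | true  = ∧-zeroʳ (y v)
          ... | false = trans (cong (y v ∧_) (E-S+ v eq)) (∧-zeroʳ (y v))

      ∁-∷ : ∀ w l → ∁ (w ∷ l) ≗ ∁ l - w
      ∁-∷ w l j with does (j ≟ w) | does (j ∈? l)
      ... | true  | true  = refl
      ... | true  | false = refl
      ... | false | true  = refl
      ... | false | false = refl

      ∁-∷-∈ : ∀ {w} l → ∁ l w ≡ false → ∁ (w ∷ l) ≗ ∁ l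
      ∁-∷-∈ {w} l w∉ j with j ≟ w
      ... | yes refl = sym w∉
      ... | no _     = refl

      ∁-+ : ∀ l v → ∁ l + v ≗ ∁ (filter (λ j → ¬? (j ≟ v)) l)
      ∁-+ l v j with j ≟ v
      ... | yes refl rewrite dec-false (j ∈? filter (λ i → ¬? (i ≟ j)) l)
              (λ j∈ → proj₂ (∈-filter⁻ (λ i → ¬? (i ≟ j)) {xs = l} j∈) refl) with ∁ l j
      ...   | true  = refl
      ...   | false = refl
      ∁-+ l v j | no j≢v rewrite does-⇔ (mk⇔ (λ j∈ → ∈-filter⁺ (λ i → ¬? (i ≟ v)) j∈ j≢v)
              (λ j∈ → proj₁ (∈-filter⁻ (λ i → ¬? (i ≟ v)) {xs = l} j∈)))
              (j ∈? l) (j ∈? filter (λ i → ¬? (i ≟ v)) l)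
              with ∁ (filter (λ i → ¬? (i ≟ v)) l) j
      ...   | true  = refl
      ...   | false = refl

      -- The induction is on a bound for the length: the step to `w ∷ l` uses the claim for `l` and
      -- for `l` with all occurrences of some `v` filtered out, and the latter is no structural part
      -- of `l`.
      vanishes : ∀ k l → length l ≤ k → E (∁ l) ≡ false
      vanishes k       []      _         = E-full
      vanishes (suc k) (w ∷ l) (s≤s l≤k) with ∁ l w in eq
      -- Here `w` already occurs in `l`, so the complement does not change.
      ... | false = trans (E-cong (∁-∷-∈ l eq)) (vanishes k l l≤k)
      ... | true  = trans (E-cong (∁-∷ w l)) (vanishes-remove (∁ l) w (vanishes k l l≤k)
        (λ v _ → trans (E-cong (∁-+ l v))
          (vanishes k (filter (λ j → ¬? (j ≟ v)) l)
            (ℕ.≤-trans (length-filter (λ j → ¬? (j ≟ v)) l) l≤k))) eq)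

      vanishes-∅ : E (λ _ → false) ≡ false
      vanishes-∅ = trans (E-cong λ j → sym (cong not (dec-true (j ∈? vs) (∈vs j))))
                         (vanishes (length vs) vs ℕ.≤-refl)

    solvable⇒odd : (∀ c → ∃[ x ] a · x ≗ c) → E full ≡ true
    solvable⇒odd solvable with E full in E-full
    ... | true  = refl
    ... | false = contradiction (trans (sym E-∅) (vanishes-∅ solvable E-full)) λ ()

-- Parity of sums over powersets

isOdd : ℕ → Bool
isOdd zero    = false
isOdd (suc m) = not (isOdd m)

Odd⇔isOdd : ∀ m → Odd m ⇔ (isOdd m ≡ true)
Odd⇔isOdd 0 = mk⇔ (λ ()) (λ ())
Odd⇔isOdd 1 = mk⇔ (λ _ → refl) (λ _ → refl)
Odd⇔isOdd (suc (suc m)) = mk⇔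
  (trans (Bool.not-involutive (isOdd m)) ∘ to ∘ trans (sym period))
  (trans period ∘ from ∘ trans (sym (Bool.not-involutive (isOdd m))))
  where
    open Equivalence (Odd⇔isOdd m)
    period : suc (suc m) % 2 ≡ m % 2
    period = trans (cong (_% 2) (ℕ.+-comm 2 m)) ([m+n]%n≡m%n m 2)

⨁-++ : (xs ys : List A) (f : A → Bool) → ⨁ (xs ++ ys) f ≡ ⨁ xs f xor ⨁ ys f
⨁-++ []       ys f = refl
⨁-++ (x ∷ xs) ys f = trans (cong (f x xor_) (⨁-++ xs ys f)) (sym (xor-assoc (f x) _ _))

⨁-map : (h : A → B) (xs : List A) (f : B → Bool) → ⨁ (map h xs) f ≡ ⨁ xs (f ∘ h)
⨁-map h []       f = refl
⨁-map h (x ∷ xs) f = cong (f (h x) xor_) (⨁-map h xs f)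

module _ {P : A → Set} (P? : Decidable P) where

  ⨁-filter : ∀ xs (f : A → Bool) → ⨁ (filter P? xs) f ≡ ⨁[ x ∈ xs ] (does (P? x) ∧ f x)
  ⨁-filter []       f = refl
  ⨁-filter (x ∷ xs) f with does (P? x)
  ... | true  = cong (f x xor_) (⨁-filter xs f)
  ... | false = ⨁-filter xs f

  isOdd-length-filter : ∀ xs → isOdd (length (filter P? xs)) ≡ ⨁[ x ∈ xs ] does (P? x)
  isOdd-length-filter []       = refl
  isOdd-length-filter (x ∷ xs) with does (P? x)
  ... | true  = cong not (isOdd-length-filter xs)
  ... | false = isOdd-length-filter xs

⨁-powerset-∷ : ∀ (x : A) xs (g : List A → Bool) → ⨁ (powerset (x ∷ xs)) g ≡
               ⨁[ p ∈ powerset xs ] g (x ∷ p) xor ⨁ (powerset xs) g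
⨁-powerset-∷ x xs g = trans (⨁-++ (map (x ∷_) (powerset xs)) (powerset xs) g)
  (cong (_xor ⨁ (powerset xs) g) (⨁-map (x ∷_) (powerset xs) g))

⨁-powerset₀ : ∀ xs (g : List A → Bool) → (∀ x p → g (x ∷ p) ≡ false) →
              ⨁ (powerset xs) g ≡ g []
⨁-powerset₀ []       g g∷≡0 = xor-identityʳ (g [])
⨁-powerset₀ (x ∷ xs) g g∷≡0 = trans (⨁-powerset-∷ x xs g)
  (cong₂ _xor_ (⨁-false (powerset xs) (g∷≡0 x)) (⨁-powerset₀ xs g g∷≡0))

⨁-powerset₁ : ∀ xs (g : List A → Bool) → (∀ x y p → g (x ∷ y ∷ p) ≡ false) →
              ⨁ (powerset xs) g ≡ g [] xor ⨁[ x ∈ xs ] g (x ∷ [])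
⨁-powerset₁ []       g _    = refl
⨁-powerset₁ (x ∷ xs) g g≡0 = trans (⨁-powerset-∷ x xs g) (trans
  (cong₂ _xor_ (⨁-powerset₀ xs (λ p → g (x ∷ p)) (g≡0 x)) (⨁-powerset₁ xs g g≡0))
  (truth-table 3 (λ p q r → p xor (q xor r)) (λ p q r → q xor (p xor r)) refl (g (x ∷ [])) (g []) _))

-- Only sublists with at most two elements contribute. A pair occurs among the sublists in one
-- order, while the double sum runs over both; splitting the value on a pair as `k x y xor k y x`
-- accounts for this, and the diagonal of `k` has to vanish.
⨁-powerset₂ : ∀ xs (g : List A → Bool) (k : A → A → Bool) →
              (∀ x y z p → g (x ∷ y ∷ z ∷ p) ≡ false) →
              (∀ x y → g (x ∷ y ∷ []) ≡ k x y xor k y x) → (∀ x → k x x ≡ false) →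
              ⨁ (powerset xs) g ≡
              g [] xor (⨁[ x ∈ xs ] g (x ∷ []) xor ⨁[ x ∈ xs ] ⨁[ y ∈ xs ] k x y)
⨁-powerset₂ []       g k g≡0 g≡k k-diag = refl
⨁-powerset₂ (x ∷ xs) g k g≡0 g≡k k-diag = begin
  ⨁ (powerset (x ∷ xs)) g
    ≡⟨ ⨁-powerset-∷ x xs g ⟩
  ⨁[ p ∈ powerset xs ] g (x ∷ p) xor ⨁ (powerset xs) g
    ≡⟨ cong₂ _xor_ (⨁-powerset₁ xs (λ p → g (x ∷ p)) (g≡0 x)) (⨁-powerset₂ xs g k g≡0 g≡k k-diag) ⟩
  (g (x ∷ []) xor ⨁[ y ∈ xs ] g (x ∷ y ∷ [])) xor (g [] xor (G xor K))
    ≡⟨ cong (λ e → (g (x ∷ []) xor e) xor (g [] xor (G xor K)))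
         (trans (⨁-cong xs (g≡k x)) (⨁-xor xs (k x) (λ y → k y x))) ⟩
  (g (x ∷ []) xor (⨁ xs (k x) xor ⨁[ y ∈ xs ] k y x)) xor (g [] xor (G xor K))
    ≡⟨ truth-table 6
         (λ p q r s t w → (p xor (q xor r)) xor (s xor (t xor w)))
         -- The constant `false` keeps the place of the diagonal term `k x x`.
         (λ p q r s t w → s xor ((p xor t) xor ((false xor q) xor (r xor w)))) refl
         (g (x ∷ [])) (⨁ xs (k x)) (⨁[ y ∈ xs ] k y x) (g []) G K ⟩
  g [] xor ((g (x ∷ []) xor G) xor ((false xor ⨁ xs (k x)) xor (⨁[ y ∈ xs ] k y x xor K)))
    ≡⟨ cong₂ (λ d e → g [] xor ((g (x ∷ []) xor G) xor ((d xor ⨁ xs (k x)) xor e)))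
         (sym (k-diag x)) (sym (⨁-xor xs (λ y → k y x) (λ y → ⨁ xs (k y)))) ⟩
  g [] xor ((g (x ∷ []) xor G) xor ((k x x xor ⨁ xs (k x)) xor ⨁[ y ∈ xs ] (k y x xor ⨁ xs (k y)))) ∎
  where
    G = ⨁[ y ∈ xs ] g (y ∷ [])
    K = ⨁[ y ∈ xs ] ⨁[ z ∈ xs ] k y z

-- The triangular board

buttons-unique : ∀ n → Unique (buttons n)
buttons-unique n = concat⁺
  (All.map⁺ (All.universal (λ r → map⁺ (λ { refl → refl }) (allFin⁺ (suc (toℕ r)))) (allFin n)))
  (AllPairs.map⁺ (AllPairs.map disjoint (allFin⁺ n)))
  where
    row : Fin n → List (Button n)
    row r = map (r ,_) (allFin (suc (toℕ r)))
    disjoint : ∀ {r r′} → r ≢ r′ → Disjoint (row r) (row r′)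
    disjoint r≢r′ (b∈row , b∈row′) with ∈-map⁻ _ b∈row | ∈-map⁻ _ b∈row′
    ... | _ , _ , refl | _ , _ , refl = r≢r′ refl

∈-buttons : ∀ {n} (b : Button n) → b ∈ buttons n
∈-buttons (r , s) = ∈-concatMap⁺ _ (Any.map (λ { refl → ∈-map⁺ (r ,_) (∈-allFin s) }) (∈-allFin r))

-- The six directions form three opposite pairs. With all coordinates successors, `∸ 1` computes
-- without truncation, and commuting `+ 1` into a successor lets the equations be solved by
-- unification.
tangent-sym : ∀ {r s r′ s′} → (suc r′ , suc s′) ∈ tangent (suc r , suc s) →
              (suc r , suc s) ∈ tangent (suc r′ , suc s′)
tangent-sym {r} {s} {r′} {s′} p
  rewrite ℕ.+-comm r 1 | ℕ.+-comm s 1 | ℕ.+-comm r′ 1 | ℕ.+-comm s′ 1 = go p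
  where
    go : ∀ {r s r′ s′} →
      (suc r′ , suc s′) ∈ ((suc r , s) ∷ (suc r , suc (suc s)) ∷ (r , s) ∷ (r , suc s) ∷
        (suc (suc r) , suc s) ∷ (suc (suc r) , suc (suc s)) ∷ []) →
      (suc r , suc s) ∈ ((suc r′ , s′) ∷ (suc r′ , suc (suc s′)) ∷ (r′ , s′) ∷ (r′ , suc s′) ∷
        (suc (suc r′) , suc s′) ∷ (suc (suc r′) , suc (suc s′)) ∷ [])
    go (here refl)                                         = there (here refl)
    go (there (here refl))                                 = here refl
    go (there (there (here refl)))                         = there (there (there (there (there (here refl)))))
    go (there (there (there (here refl))))                 = there (there (there (there (here refl))))
    go (there (there (there (there (here refl)))))         = there (there (there (here refl)))
    go (there (there (there (there (there (here refl)))))) = there (there (here refl))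

tangent-irrefl : ∀ {r s} → ¬ (suc r , suc s) ∈ tangent (suc r , suc s)
tangent-irrefl {r} {s} p rewrite ℕ.+-comm r 1 | ℕ.+-comm s 1 with p
... | there (there (there (there (there (there ())))))

bit : Bool → ℕ
bit b = if b then 1 else 0

module _ {n : ℕ} where

  open DecMembership (_≟ᴮ_ {n}) using (_∈?_)

  -- Pressing buttons as multiplication by a symmetric matrix

  Neighbor-sym : ∀ {b c : Button n} → Neighbor b c → Neighbor c b
  Neighbor-sym = tangent-sym

  neighbor?-sym : ∀ (b c : Button n) → does (neighbor? b c) ≡ does (neighbor? c b)
  neighbor?-sym b c = does-⇔
    (mk⇔ (Neighbor-sym {b} {c}) (Neighbor-sym {c} {b})) (neighbor? b c) (neighbor? c b)

  neighbor?-irrefl : ∀ (b : Button n) → does (neighbor? b b) ≡ false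
  neighbor?-irrefl b = dec-false (neighbor? b b) tangent-irrefl

  -- The row is the affected button and the column the pressed one: this is literally the test that
  -- `press c` makes at `b`.
  toggles : Button n → Button n → Bool
  toggles b c = does ((b ≟ᴮ c) ⊎-dec neighbor? c b)

  toggles-sym : ∀ b c → toggles b c ≡ toggles c b
  toggles-sym b c = does-⇔
    (mk⇔ (Sum.map sym (Neighbor-sym {c} {b})) (Sum.map sym (Neighbor-sym {b} {c})))
    ((b ≟ᴮ c) ⊎-dec neighbor? c b) ((c ≟ᴮ b) ⊎-dec neighbor? b c)

  foldr-press : ∀ (X C : ButtonSet n) b l →
                foldr press C (filterᵇ X l) b ≡ ⨁[ c ∈ l ] (toggles b c ∧ X c) xor C b
  foldr-press X C b []      = refl
  foldr-press X C b (c ∷ l) with X c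
  ... | false rewrite ∧-zeroʳ (toggles b c) = foldr-press X C b l
  ... | true with toggles b c
  ...   | true  = trans (cong not (foldr-press X C b l))
                        (Bool.not-distribˡ-xor (⨁[ j ∈ l ] (toggles b j ∧ X j)) (C b))
  ...   | false = foldr-press X C b l

  -- Parity of the coverings of a set of buttons

  IsPartitionOf : ButtonSet n → List (List (Button n)) → Set
  IsPartitionOf S P = All (λ b → length (blocksContaining b P) ≡ bit (S b)) (buttons n)

  partitionOf? : ∀ S → Decidable (IsPartitionOf S)
  partitionOf? S P = all? (λ b → length (blocksContaining b P) ℕ.≟ bit (S b)) (buttons n)

  -- This is the parity of the number of subfamilies of `Q` that partition `S`; buttons outside `S`
  -- must lie in no block. Leaving `Q` arbitrary allows induction on the list of available pieces.
  covers : List (List (Button n)) → ButtonSet n → Bool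
  covers Q S = ⨁[ P ∈ powerset Q ] does (partitionOf? S P)

  covers-cong : ∀ Q {S T} → S ≗ T → covers Q S ≡ covers Q T
  covers-cong Q S≗T = ⨁-cong (powerset Q) λ P → does-⇔
    (mk⇔ (All.map λ {b} eq → trans eq (cong bit (S≗T b)))
         (All.map λ {b} eq → trans eq (cong bit (sym (S≗T b)))))
    (partitionOf? _ P) (partitionOf? _ P)

  infix 4 _⊆_ _⊆?_
  infixl 8 _∖_

  _⊆_ : List (Button n) → ButtonSet n → Set
  p ⊆ S = All (λ b → S b ≡ true) p

  _⊆?_ : ∀ p S → Dec (p ⊆ S)
  p ⊆? S = all? (λ b → S b Bool.≟ true) p

  _∖_ : ButtonSet n → List (Button n) → ButtonSet n
  (S ∖ p) b = S b ∧ not (does (b ∈? p))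

  ∖-∈ : ∀ S {p b} → b ∈ p → (S ∖ p) b ≡ false
  ∖-∈ S {p} {b} b∈p rewrite dec-true (b ∈? p) b∈p = ∧-zeroʳ (S b)

  ∖-∉ : ∀ S {p b} → ¬ b ∈ p → (S ∖ p) b ≡ S b
  ∖-∉ S {p} {b} b∉p rewrite dec-false (b ∈? p) b∉p = ∧-identityʳ (S b)

  ∖-comm : ∀ S p q → S ∖ p ∖ q ≗ S ∖ q ∖ p
  ∖-comm S p q b = truth-table 3 (λ x y z → (x ∧ y) ∧ z) (λ x y z → (x ∧ z) ∧ y) refl
    (S b) (not (does (b ∈? p))) (not (does (b ∈? q)))

  ⊆-∖-false : ∀ {S p q v} → v ∈ p → v ∈ q → does (q ⊆? S ∖ p) ≡ false
  ⊆-∖-false {S} {p} {q} v∈p v∈q = dec-false (q ⊆? S ∖ p) λ q⊆ →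
    contradiction (trans (sym (All.lookup q⊆ v∈q)) (∖-∈ S v∈p)) λ ()

  -- Both conjunctions say that `p` and `q` are disjoint and contained in `S`.
  ⊆-∖-swap : ∀ S p q → does (q ⊆? S) ∧ does (p ⊆? S ∖ q) ≡ does (p ⊆? S) ∧ does (q ⊆? S ∖ p)
  ⊆-∖-swap S p q = does-⇔ (mk⇔ (swap p q) (swap q p))
    ((q ⊆? S) ×-dec (p ⊆? S ∖ q)) ((p ⊆? S) ×-dec (q ⊆? S ∖ p))
    where
      swap : ∀ p q → (q ⊆ S) × (p ⊆ S ∖ q) → (p ⊆ S) × (q ⊆ S ∖ p)
      swap p q (q⊆S , p⊆S∖q) =
        All.map (λ {b} → ∧-trueˡ (S b)) p⊆S∖q ,
        All.tabulate λ b∈q → trans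
          (∖-∉ S λ b∈p → contradiction (trans (sym (All.lookup p⊆S∖q b∈p)) (∖-∈ S b∈q)) λ ())
          (All.lookup q⊆S b∈q)
        where
          ∧-trueˡ : ∀ x {y} → x ∧ y ≡ true → x ≡ true
          ∧-trueˡ true _ = refl

  count-∷ : ∀ b p P → length (blocksContaining b (p ∷ P)) ≡
            bit (does (b ∈? p)) ℕ.+ length (blocksContaining b P)
  count-∷ b p P with does (b ∈? p)
  ... | true  = refl
  ... | false = refl

  -- Compare the block counts button by button. A button of `p` has its count used up by `p`, so it
  -- must belong to `S` and lie in no block of `P`; at the other buttons nothing changes.
  partitionOf?-∷ : ∀ S p P →
    does (partitionOf? S (p ∷ P)) ≡ does (p ⊆? S) ∧ does (partitionOf? (S ∖ p) P)
  partitionOf?-∷ S p P = does-⇔ (mk⇔ to from)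
    (partitionOf? S (p ∷ P)) ((p ⊆? S) ×-dec partitionOf? (S ∖ p) P)
    where
      to-pointwise : ∀ x s {m} → bit x ℕ.+ m ≡ bit s → (x ≡ true → s ≡ true) × m ≡ bit (s ∧ not x)
      to-pointwise true  true  refl = (λ _ → refl) , refl
      to-pointwise false true  eq   = (λ _ → refl) , eq
      to-pointwise false false eq   = (λ ()) , eq

      from-pointwise : ∀ x s {m} → (x ≡ true → s ≡ true) → m ≡ bit (s ∧ not x) → bit x ℕ.+ m ≡ bit s
      from-pointwise true  s h refl rewrite h refl = refl
      from-pointwise false s h eq   = trans eq (cong bit (∧-identityʳ s))

      to : IsPartitionOf S (p ∷ P) →
           (p ⊆ S) × IsPartitionOf (S ∖ p) P
      to part =
        All.tabulate (λ {b} b∈p → proj₁ (pw b (∈-buttons b)) (dec-true (b ∈? p) b∈p)) ,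
        All.tabulate (λ {b} b∈ → proj₂ (pw b b∈))
        where
          pw = λ b b∈ → to-pointwise (does (b ∈? p)) (S b)
                 (trans (sym (count-∷ b p P)) (All.lookup part b∈))

      from : (p ⊆ S) × IsPartitionOf (S ∖ p) P →
             IsPartitionOf S (p ∷ P)
      from (p⊆S , part) = All.map (λ {b} eq → trans (count-∷ b p P)
        (from-pointwise (does (b ∈? p)) (S b) (p-true b) eq)) part
        where
          p-true : ∀ b → does (b ∈? p) ≡ true → S b ≡ true
          p-true b eq with yes b∈p ← b ∈? p = All.lookup p⊆S b∈p

  covers-∷ : ∀ p Q S → covers (p ∷ Q) S ≡ (does (p ⊆? S) ∧ covers Q (S ∖ p)) xor covers Q S
  covers-∷ p Q S = trans (⨁-powerset-∷ p Q (λ P → does (partitionOf? S P)))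
    (cong (_xor covers Q S) (trans (⨁-cong (powerset Q) (partitionOf?-∷ S p))
      (⨁-∧ (powerset Q) (does (p ⊆? S)) _)))

  -- Pieces are nonempty, so none fits into the empty set, and only the empty family partitions it.
  covers-∅ : ∀ {Q} → All IsPiece Q → covers Q ∅ ≡ true
  covers-∅ []                = trans (xor-identityʳ _)
    (dec-true (partitionOf? ∅ []) (All.tabulate λ _ → refl))
  covers-∅ {[] ∷ Q}      (() ∷ _)
  covers-∅ {(x ∷ p) ∷ Q} (_ ∷ pieces-Q) = trans (covers-∷ (x ∷ p) Q ∅) (covers-∅ pieces-Q)

  -- The sum runs over the unique piece of each covering that contains v.
  covers-expand : ∀ Q S {v} → S v ≡ true → covers Q S ≡
                  ⨁[ p ∈ Q ] (does (v ∈? p) ∧ does (p ⊆? S) ∧ covers Q (S ∖ p))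
  covers-expand []      S {v} v∈S = trans (xor-identityʳ _)
    (dec-false (partitionOf? S []) λ part →
      0≢1 (trans (All.lookup part (∈-buttons v)) (cong bit v∈S)))
    where
      0≢1 : 0 ≢ 1
      0≢1 ()
  covers-expand (q ∷ Q) S {v} v∈S = begin
    covers (q ∷ Q) S
      ≡⟨ covers-∷ q Q S ⟩
    (does (q ⊆? S) ∧ covers Q (S ∖ q)) xor covers Q S
      -- Coverings that use `q` are separated from those that avoid it; the latter are expanded by
      -- induction.
      ≡⟨ cong₂ _xor_ (with-q (v ∈? q)) (covers-expand Q S v∈S) ⟩
    (head xor ⨁ Q both) xor ⨁ Q without
      ≡⟨ xor-assoc head _ _ ⟩
    head xor (⨁ Q both xor ⨁ Q without)
      ≡⟨ cong (head xor_) (sym (⨁-xor Q both without)) ⟩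
    head xor ⨁[ p ∈ Q ] (both p xor without p)
      ≡⟨ cong (head xor_) (⨁-cong Q λ p → sym (trans
           (cong (λ e → does (v ∈? p) ∧ does (p ⊆? S) ∧ e) (covers-∷ q Q (S ∖ p)))
           (truth-table 5 (λ x y z s t → x ∧ (y ∧ ((z ∧ s) xor t)))
             (λ x y z s t → (x ∧ (y ∧ (z ∧ s))) xor (x ∧ (y ∧ t))) refl
             (does (v ∈? p)) (does (p ⊆? S)) (does (q ⊆? S ∖ p)) _ _))) ⟩
    head xor ⨁[ p ∈ Q ] (does (v ∈? p) ∧ does (p ⊆? S) ∧ covers (q ∷ Q) (S ∖ p)) ∎
    where
      head = does (v ∈? q) ∧ does (q ⊆? S) ∧ covers (q ∷ Q) (S ∖ q)
      both = λ p → does (v ∈? p) ∧ does (p ⊆? S) ∧ does (q ⊆? S ∖ p) ∧ covers Q (S ∖ p ∖ q)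
      without = λ p → does (v ∈? p) ∧ does (p ⊆? S) ∧ covers Q (S ∖ p)

      -- If `v` lies in `q`, no piece disjoint from `q` contains `v`, and only `head` survives,
      -- where `q` cannot be used a second time. Otherwise `head` is zero, and the expansion of
      -- `S ∖ q` along `v` gives `both` after the removals of `p` and `q` are interchanged.
      with-q : Dec (v ∈ q) → does (q ⊆? S) ∧ covers Q (S ∖ q) ≡ head xor ⨁ Q both
      with-q (yes v∈q) = sym (trans (cong₂ _xor_ head≡ (⨁-false Q both≡)) (xor-identityʳ _))
        where
          head≡ : head ≡ does (q ⊆? S) ∧ covers Q (S ∖ q)
          head≡ rewrite dec-true (v ∈? q) v∈q | covers-∷ q Q (S ∖ q)
                      | ⊆-∖-false {S} v∈q v∈q = refl
          both≡ : ∀ p → both p ≡ false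
          both≡ p with v ∈? p
          ... | no _ = refl
          ... | yes v∈p rewrite ⊆-∖-false {S} v∈p v∈q = ∧-zeroʳ (does (p ⊆? S))
      with-q (no v∉q) = begin
        does (q ⊆? S) ∧ covers Q (S ∖ q)
          ≡⟨ cong (does (q ⊆? S) ∧_) (covers-expand Q (S ∖ q) (trans (∖-∉ S v∉q) v∈S)) ⟩
        does (q ⊆? S) ∧ ⨁[ p ∈ Q ] (does (v ∈? p) ∧ does (p ⊆? S ∖ q) ∧ covers Q (S ∖ q ∖ p))
          ≡⟨ sym (⨁-∧ Q (does (q ⊆? S)) _) ⟩
        ⨁[ p ∈ Q ] (does (q ⊆? S) ∧ does (v ∈? p) ∧ does (p ⊆? S ∖ q) ∧ covers Q (S ∖ q ∖ p))
          ≡⟨ ⨁-cong Q pointwise ⟩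
        ⨁ Q both
          ≡⟨ cong (_xor ⨁ Q both) (sym head≡) ⟩
        head xor ⨁ Q both ∎
        where
          head≡ : head ≡ false
          head≡ rewrite dec-false (v ∈? q) v∉q = refl
          pointwise : ∀ p →
            does (q ⊆? S) ∧ does (v ∈? p) ∧ does (p ⊆? S ∖ q) ∧ covers Q (S ∖ q ∖ p) ≡ both p
          pointwise p = begin
            x ∧ y ∧ z ∧ covers Q (S ∖ q ∖ p)
              ≡⟨ truth-table 4 (λ x y z t → x ∧ (y ∧ (z ∧ t))) (λ x y z t → y ∧ ((x ∧ z) ∧ t)) refl x y z _ ⟩
            y ∧ (x ∧ z) ∧ covers Q (S ∖ q ∖ p)
              ≡⟨ cong₂ (λ e f → y ∧ e ∧ f) (⊆-∖-swap S p q) (covers-cong Q (∖-comm S q p)) ⟩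
            y ∧ (does (p ⊆? S) ∧ does (q ⊆? S ∖ p)) ∧ covers Q (S ∖ p ∖ q)
              ≡⟨ cong (y ∧_) (∧-assoc (does (p ⊆? S)) _ _) ⟩
            both p ∎
            where
              x = does (q ⊆? S)
              y = does (v ∈? p)
              z = does (p ⊆? S ∖ q)

  -- A piece containing `v` is the singleton or a pair of `v` with a neighbor. The pair may be
  -- listed in either order, which the symmetry of `F` absorbs; `k x y` records the order in which
  -- `v` comes first.
  ⨁-pieces : ∀ v (F : List (Button n) → Bool) →
             (∀ x y → F (x ∷ y ∷ []) ≡ F (y ∷ x ∷ [])) →
             ⨁[ p ∈ pieces n ] (does (v ∈? p) ∧ F p) ≡
             F (v ∷ []) xor ⨁[ c ∈ buttons n ] (does (neighbor? v c) ∧ F (v ∷ c ∷ []))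
  ⨁-pieces v F F-swap = begin
    ⨁[ p ∈ pieces n ] (does (v ∈? p) ∧ F p)
      ≡⟨ ⨁-filter isPiece? (powerset (buttons n)) _ ⟩
    ⨁ (powerset (buttons n)) g
      -- The term `g []` reduces to `false`, the empty list being no piece.
      ≡⟨ ⨁-powerset₂ (buttons n) g k (λ _ _ _ _ → refl) g≡k k-diag ⟩
    ⨁[ x ∈ buttons n ] g (x ∷ []) xor ⨁[ x ∈ buttons n ] ⨁[ y ∈ buttons n ] k x y
      ≡⟨ cong₂ _xor_
           (trans (⨁-cong (buttons n) λ x →
             cong (_∧ F (x ∷ [])) (trans (∨-identityʳ _) (≟-sym _≟ᴮ_ v x)))
             (select (λ x → F (x ∷ []))))
           (trans (⨁-cong (buttons n) λ x → ⨁-∧ (buttons n) (does (x ≟ᴮ v)) _)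
             (select (λ x → ⨁[ y ∈ buttons n ] (does (neighbor? x y) ∧ F (x ∷ y ∷ []))))) ⟩
    F (v ∷ []) xor ⨁[ c ∈ buttons n ] (does (neighbor? v c) ∧ F (v ∷ c ∷ [])) ∎
    where
      g : List (Button n) → Bool
      g p = does (isPiece? p) ∧ does (v ∈? p) ∧ F p

      k : Button n → Button n → Bool
      k x y = does (x ≟ᴮ v) ∧ does (neighbor? x y) ∧ F (x ∷ y ∷ [])

      select : (f : Button n → Bool) → ⨁[ x ∈ buttons n ] (does (x ≟ᴮ v) ∧ f x) ≡ f v
      select f = ⨁-δ _≟ᴮ_ f (buttons-unique n) (∈-buttons v)

      k-diag : ∀ x → k x x ≡ false
      k-diag x rewrite neighbor?-irrefl x = ∧-zeroʳ _

      g≡k : ∀ x y → g (x ∷ y ∷ []) ≡ k x y xor k y x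
      g≡k x y rewrite neighbor?-sym y x | F-swap y x | ≟-sym _≟ᴮ_ v x | ≟-sym _≟ᴮ_ v y
        with x ≟ᴮ v | y ≟ᴮ v
      ... | yes refl | yes refl rewrite neighbor?-irrefl x = refl
      ... | yes _    | no _  = sym (xor-identityʳ _)
      ... | no _     | yes _ = refl
      ... | no _     | no _  = ∧-zeroʳ _

  open SymmetricMatrix _≟ᴮ_ (buttons n) (buttons-unique n) ∈-buttons toggles toggles-sym

  -- The singleton piece at `v` yields the diagonal term, as every button toggles itself. For `c`
  -- different from `v`, `toggles v c` is adjacency, so the pairs yield the sum.
  coverings-expand : ∀ S v → S v ≡ true → covers (pieces n) S ≡
    (toggles v v ∧ covers (pieces n) (S - v)) xor
    ⨁[ c ∈ buttons n ] ((S - v) c ∧ toggles v c ∧ covers (pieces n) (S - v - c))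
  coverings-expand S v v∈S = begin
    E S
      ≡⟨ covers-expand (pieces n) S v∈S ⟩
    ⨁[ p ∈ pieces n ] (does (v ∈? p) ∧ F p)
      ≡⟨ ⨁-pieces v F F-swap ⟩
    F (v ∷ []) xor ⨁[ c ∈ buttons n ] (does (neighbor? v c) ∧ F (v ∷ c ∷ []))
      ≡⟨ cong₂ _xor_ singleton (⨁-cong (buttons n) pair) ⟩
    (toggles v v ∧ E (S - v)) xor
      ⨁[ c ∈ buttons n ] ((S - v) c ∧ toggles v c ∧ E (S - v - c)) ∎
    where
      E = covers (pieces n)

      F : List (Button n) → Bool
      F p = does (p ⊆? S) ∧ E (S ∖ p)

      F-swap : ∀ x y → F (x ∷ y ∷ []) ≡ F (y ∷ x ∷ [])
      F-swap x y = cong₂ _∧_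
        (truth-table 2 (λ p q → p ∧ (q ∧ true)) (λ p q → q ∧ (p ∧ true)) refl
          (does (S x Bool.≟ true)) (does (S y Bool.≟ true)))
        (covers-cong (pieces n) λ b →
          truth-table 3 (λ p q r → p ∧ not (q ∨ (r ∨ false))) (λ p q r → p ∧ not (r ∨ (q ∨ false)))
            refl (S b) (does (b ≟ᴮ x)) (does (b ≟ᴮ y)))

      singleton : F (v ∷ []) ≡ toggles v v ∧ E (S - v)
      singleton rewrite v∈S | dec-true (v ≟ᴮ v) refl =
        covers-cong (pieces n) λ b → cong (λ e → S b ∧ not e) (∨-identityʳ _)

      does-≟-true : ∀ x → does (x Bool.≟ true) ≡ x
      does-≟-true true  = refl
      does-≟-true false = refl

      pair : ∀ c → does (neighbor? v c) ∧ F (v ∷ c ∷ []) ≡ (S - v) c ∧ toggles v c ∧ E (S - v - c)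
      pair c with c ≟ᴮ v
      -- Both sides vanish: `v` is not its own neighbor and does not lie in `S - v`.
      ... | yes refl rewrite neighbor?-irrefl c | ∧-zeroʳ (S c) = refl
      ... | no c≢v rewrite dec-false (v ≟ᴮ c) (c≢v ∘ sym) | neighbor?-sym c v | v∈S = begin
        does (neighbor? v c) ∧ (does (S c Bool.≟ true) ∧ true) ∧ E (S ∖ (v ∷ c ∷ []))
          ≡⟨ cong₂ (λ e f → does (neighbor? v c) ∧ (e ∧ true) ∧ f) (does-≟-true (S c))
               (covers-cong (pieces n) λ b →
                 truth-table 3 (λ p q r → p ∧ not (q ∨ (r ∨ false))) (λ p q r → (p ∧ not q) ∧ not r)
                   refl (S b) (does (b ≟ᴮ v)) (does (b ≟ᴮ c))) ⟩
        does (neighbor? v c) ∧ (S c ∧ true) ∧ E (S - v - c)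
          ≡⟨ truth-table 3 (λ p q r → p ∧ ((q ∧ true) ∧ r)) (λ p q r → (q ∧ true) ∧ (p ∧ r)) refl
               (does (neighbor? v c)) (S c) (E (S - v - c)) ⟩
        (S c ∧ true) ∧ does (neighbor? v c) ∧ E (S - v - c) ∎

  open Matchings (covers (pieces n)) (covers-cong (pieces n))
    (covers-∅ (All.all-filter isPiece? (powerset (buttons n)))) coverings-expand public

  -- The game as a linear system, and the parity of the number of coverings

  isSolution⇒ : ∀ {X C : ButtonSet n} → IsSolution X C → toggles · X ≗ C
  isSolution⇒ {X} {C} sol b = xor-cancel (trans (sym (foldr-press X C b (buttons n))) (sol b))
    where
      xor-cancel : ∀ {x y} → x xor y ≡ false → x ≡ y
      xor-cancel {true}  {true}  _ = refl
      xor-cancel {false} {false} _ = refl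

  isSolution⇐ : ∀ {X C : ButtonSet n} → toggles · X ≗ C → IsSolution X C
  isSolution⇐ {X} {C} eq b = trans (foldr-press X C b (buttons n))
    (trans (cong (_xor C b) (eq b)) (xor-same (C b)))

  -- On the full set `bit` evaluates to 1, so `partitionOf? full` is `isPartition?` by computation.
  isOdd-numberOfCoverings : isOdd (numberOfCoverings n) ≡ covers (pieces n) full
  isOdd-numberOfCoverings = isOdd-length-filter isPartition? (powerset (pieces n))

theorem3 : (n : ℕ) → 1 ≤ n →
    ((C : ButtonSet n) → ∃[ X ] IsSolution X C) ⇔ Odd (numberOfCoverings n)
theorem3 n _ = mk⇔
  (λ solve → from (trans (isOdd-numberOfCoverings {n})
    (solvable⇒odd {n} λ C → map₂ isSolution⇒ (solve C))))
  (λ odd C → map₂ isSolution⇐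
    (odd⇒solvable {n} (trans (sym (isOdd-numberOfCoverings {n})) (to odd)) C))
  where open Equivalence (Odd⇔isOdd (numberOfCoverings n))
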